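{- There exists an ideal $\mathcal{I}$ (on an infinite countable set) of Borel class $\mathbf{\Sigma}^0_6$ such that $\mathrm{rk}(\mathcal{I})>2$ and $\mathcal{I}$ does not contain an isomorphic copy of $\mathrm{Fin}^3$, i.e. $\mathrm{Fin}^3\not\sqsubseteq\mathcal{I}$.
   Context: An ideal on an infinite countable set $X$ is a collection $\mathcal{I}\subseteq\mathcal{P}(X)$ closed under subsets and finite unions, with $\mathcal{I}\neq\mathcal{P}(X)$ and containing all finite subsets of $X$ (so $X=\bigcup\mathcal{I}$). The power set $\mathcal{P}(X)$ is identified with $2^X$ (product topology, $2=\{0,1\}$ discrete) via characteristic functions; Borel classes such as $\mathbf{\Sigma}^0_\alpha$ and analyticity of subsets of $\mathcal{P}(X)$ (in particular of ideals) refer to this topology. For an ideal $\mathcal{I}$ on $X$, $\mathcal{I}^\star=\{X\setminus A: A\in\mathcal{I}\}$ is the dual filter. For $\mathcal{A},\mathcal{B},\mathcal{S}\subseteq\mathcal{P}(X)$, $\mathcal{S}$ separates $\mathcal{A}$ from $\mathcal{B}$ if $\mathcal{A}\subseteq\mathcal{S}$ and $\mathcal{S}\cap\mathcal{B}=\emptyset$. The (Borel separation) rank of an analytic ideal $\mathcal{I}$ is $$\mathrm{rk}(\mathcal{I})=\min\{\alpha<\omega_1:\text{ there is }\mathcal{S}\in\mathbf{\Sigma}^0_{1+\alpha}\text{ separating }\mathcal{I}\text{ from }\mathcal{I}^\star\}.$$ Thus $\mathrm{rk}(\mathcal{I})>2$ means that no $\mathbf{\Sigma}^0_3$ set separates $\mathcal{I}$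 from $\mathcal{I}^\star$. For ideals $\mathcal{I},\mathcal{J}$, one says $\mathcal{J}$ contains an isomorphic copy of $\mathcal{I}$, written $\mathcal{I}\sqsubseteq\mathcal{J}$, if there is a bijection $f:\bigcup\mathcal{J}\to\bigcup\mathcal{I}$ such that for every $A\subseteq\bigcup\mathcal{I}$, $A\in\mathcal{I}$ implies $f^{ -1}[A]\in\mathcal{J}$. $\mathrm{Fin}^1=\mathrm{Fin}=[\omega]^{<\omega}$ is the ideal of finite subsets of $\omega$, and $\mathrm{Fin}^{n+1}=\mathrm{Fin}\otimes\mathrm{Fin}^n$ (an ideal on $\omega^{n+1}$), where $\mathcal{I}\otimes\mathcal{J}=\{A\subseteq\bigcup\mathcal{I}\times\bigcup\mathcal{J}:\{x\in\bigcup\mathcal{I}:A_{(x)}\notin\mathcal{J}\}\in\mathcal{I}\}$ and $A_{(x)}=\{y:(x,y)\in A\}$. -}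

module Defs where

open import Level using (0ℓ)
open import Data.Bool using (Bool; true; false; not; _∨_)
open import Data.Nat using (ℕ; zero; suc; _≤_; _<_)
open import Data.List using (List)
open import Data.List.Relation.Unary.All using (All)
import Data.List.Membership.Propositional as List
open import Data.Product using (Σ-syntax; ∃-syntax; _×_; _,_)
open import Function using (_∘_)
open import Function.Bundles using (_⇔_; _⤖_; module Bijection)
open import Relation.Binary.PropositionalEquality using (_≡_; _≗_)
open import Relation.Nullary using (¬_)
open import Relation.Unary
  using (Pred; _∈_; _∉_; _⊆_; _∩_; _≐_; ∁; Empty; ⋃)

-- Subsets of X are characteristic functions, i.e. points of 2^X.  In the
-- presence of excluded middle every predicate on X has one.  Operators with
-- an index ₛ act on subsets of X; the operators of Relation.Unary act on
-- families of subsets.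

𝒫 : Set → Set
𝒫 X = X → Bool

Family : Set → Set₁
Family X = Pred (𝒫 X) 0ℓ

module _ {X : Set} where

  infix  4 _∈ₛ_ _⊆ₛ_
  infixr 6 _∪ₛ_

  _∈ₛ_ : X → 𝒫 X → Set
  x ∈ₛ A = A x ≡ true

  _⊆ₛ_ : 𝒫 X → 𝒫 X → Set
  A ⊆ₛ B = ∀ x → x ∈ₛ A → x ∈ₛ B

  _∪ₛ_ : 𝒫 X → 𝒫 X → 𝒫 X
  (A ∪ₛ B) x = A x ∨ B x

  ∁ₛ : 𝒫 X → 𝒫 X
  ∁ₛ A = not ∘ A

  fullₛ : 𝒫 X
  fullₛ _ = true

  Finiteₛ : Family X
  Finiteₛ A = ∃[ xs ] ∀ x → x ∈ₛ A → x List.∈ xs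

CountablyInfinite : Set → Set
CountablyInfinite X = X ⤖ ℕ

record Ideal (X : Set) : Set₁ where
  field
    sets       : Family X
    downward   : ∀ {A B} → A ⊆ₛ B → B ∈ sets → A ∈ sets
    ∪-closed   : ∀ {A B} → A ∈ sets → B ∈ sets → (A ∪ₛ B) ∈ sets
    finite-∈   : Finiteₛ ⊆ sets
    proper     : fullₛ ∉ sets

-- Equality of subsets is pointwise equality, since functions are not assumed
-- to be extensional.
_⋆ : {X : Set} → Family X → Family X
(ℐ ⋆) B = ∃[ A ] A ∈ ℐ × B ≗ ∁ₛ A

-- Openness in the product topology on 2^X: around each of its points U
-- contains a basic neighbourhood, given by finitely many coordinates.
Open : {X : Set} → Family X → Set
Open U = ∀ A → A ∈ U →
  ∃[ xs ] ∀ B → All (λ x → B x ≡ A x) xs → B ∈ U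

-- The finite levels of the Borel hierarchy.  A family is in Π⁰ₙ when its
-- complement is in Σ⁰ₙ; for n > 1, Σ⁰ₙ consists of the unions of sequences T
-- with T i in Π⁰ of level β i < n.  The hierarchy starts at 1: Σ⁰ 0 is empty,
-- so the second constructor yields nothing at n = 0 or n = 1.
data Σ⁰ {X : Set} : ℕ → Family X → Set₁ where
  open-Σ⁰  : ∀ {U} → Open U → Σ⁰ 1 U
  union-Σ⁰ : ∀ {n S} (β : ℕ → ℕ) (T : ℕ → Family X) →
             (∀ i → β i < n) → (∀ i → Σ⁰ (β i) (∁ (T i))) →
             S ≐ ⋃ ℕ T → Σ⁰ n S

_separates_from_ : {X : Set} → Family X → Family X → Family X → Set
𝒮 separates 𝒜 from ℬ = 𝒜 ⊆ 𝒮 × Empty (𝒮 ∩ ℬ)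

Separable : {X : Set} → ℕ → Family X → Set₁
Separable α ℐ = ∃[ 𝒮 ] Σ⁰ (suc α) 𝒮 × 𝒮 separates ℐ from (ℐ ⋆)

-- The rank is the least α with Separable α ℐ.  For finite α, that it exceeds
-- α says that no β ≤ α has this property.
infix 4 rk_>_
rk_>_ : {X : Set} → Family X → ℕ → Set₁
rk ℐ > α = ∀ β → β ≤ α → ¬ Separable β ℐ

-- An ideal contains all singletons, so the union of an ideal on X is X; hence
-- the bijection between the unions is one between the underlying types.
infix 4 _⊑_
_⊑_ : {X Y : Set} → Family X → Family Y → Set
_⊑_ {X} {Y} ℐ 𝒥 =
  Σ[ f ∈ Y ⤖ X ] ∀ A → A ∈ ℐ → (A ∘ Bijection.to f) ∈ 𝒥

section : {X Y : Set} → 𝒫 (X × Y) → X → 𝒫 Y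
section A x y = A (x , y)

-- D is the set of those x whose section is not in 𝒥.
infixr 7 _⊗_
_⊗_ : {X Y : Set} → Family X → Family Y → Family (X × Y)
(ℐ ⊗ 𝒥) A = ∃[ D ] (∀ x → x ∈ₛ D ⇔ section A x ∉ 𝒥) × D ∈ ℐ

ω^[1+_] : ℕ → Set
ω^[1+ zero  ] = ℕ
ω^[1+ suc n ] = ℕ × ω^[1+ n ]

Fin : Family ℕ
Fin = Finiteₛ

Fin^[1+_] : ∀ n → Family ω^[1+ n ]
Fin^[1+ zero  ] = Fin
Fin^[1+ suc n ] = Fin ⊗ Fin^[1+ n ]

module Submission where

open import Defs
open import Axiom.ExcludedMiddle using (ExcludedMiddle)
open import Data.Bool using (true; false; not)
open import Data.Bool.Properties using (not-involutive)
open import Data.Empty using (⊥)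
open import Data.List as List using (List; upTo)
open import Data.List.Extrema.Nat using (max; xs≤max)
open import Data.List.Membership.Propositional.Properties using (∈-upTo⁺)
open import Data.List.Relation.Unary.All as All using (All)
open import Data.Nat
  using (ℕ; zero; suc; _+_; _≤_; _<_; _⊔_; z≤n; s≤s; _<?_)
open import Data.Nat.Properties
open import Data.Product
  using (Σ-syntax; ∃-syntax; _×_; _,_; proj₁; proj₂)
open import Data.Product.Function.NonDependent.Propositional using (_×-↠_)
open import Data.Sum using (inj₁; inj₂)
open import Data.Unit using (⊤; tt)
open import Function using (_∘_)
open import Function.Bundles
  using (_↠_; mk↠ₛ; mk⇔; module Surjection; module Bijection)
open import Function.Construct.Composition using (_↠-∘_)
open import Function.Construct.Identity using (↠-id; ⤖-id)
open import Level using (0ℓ)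
open import Relation.Binary.PropositionalEquality
  using (_≡_; _≢_; refl; sym; trans; cong; cong₂; subst)
open import Relation.Nullary using (¬_; does; yes; no; contradiction)
open import Relation.Nullary.Decidable using (decidable-stable)
open import Relation.Unary using (_∈_; _∉_; _≐_; ∁; ⋂)

-- Colour ℕ by quadruples (p , a , i , b) so that every colour occurs
-- infinitely often, and consider the ideal of all E such that for some n
--   * for p ≥ n and almost all a: for all i, the set of points of E coloured
--     (p , a , i , -) uses only finitely many b (`Thin`);
--   * for p < n and almost all a: for all i ≥ n, almost every colour
--     (p , a , i , b) occurs only finitely often in E (`Small`).
--
-- Rank.  Given S = ⋃ᵢ ⋂ⱼ Oᵢⱼ with Oᵢⱼ open, define E recursively.  Let f x i be
-- the largest over i′ ≤ i of the least j such that E restricted to [0, x)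
-- does not yet force E into Oᵢ′ⱼ; a point x coloured (p , a , i , b) is omitted
-- from E when a ≥ f x p and b ≥ f x i.  If E ∉ S, then every f x i stays
-- bounded as x grows and E is in the ideal (n = 0); if E ∈ ⋂ⱼ Oₙⱼ, then f x i
-- tends to infinity for all i ≥ n and the complement of E is in the ideal.
--
-- No copy of Fin³.  For Φ : ℕ → ω³ pulling Fin³ back into the ideal, let
-- Q r = {x : first coordinate of Φ x ≤ r}.  Q r is in the ideal, so for each p
-- there are a ≥ r and i with Q r `Small` at (p , a , i), leaving outside
-- Q r a sequence with pairwise different b.  It can be thinned so that each
-- section of its image is in Fin².  As each section meets only the sequences
-- of finitely many r, the union over all r is the preimage of a set in Fin³;
-- but since p runs through every value for infinitely many r, it fails to be
-- `Thin` at every p for infinitely many a.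

-- Quantifiers over almost all and infinitely many numbers.

infix 2 ∀∞

∀∞ : (ℕ → Set) → Set
∀∞ S = ∃[ N ] ∀ m → N ≤ m → S m

syntax ∀∞ (λ m → S) = ∀∞[ m ] S

∃∞ : (ℕ → Set) → Set
∃∞ S = ∀ N → ∃[ m ] N ≤ m × S m

∀∞-map : ∀ {S T} → (∀ m → S m → T m) → ∀∞ S → ∀∞ T
∀∞-map f (N , h) = N , λ m N≤m → f m (h m N≤m)

∀∞-zip : ∀ {S T U} → (∀ m → S m → T m → U m) → ∀∞ S → ∀∞ T → ∀∞ U
∀∞-zip f (M , g) (N , h) = M ⊔ N , λ m le →
  f m (g m (m⊔n≤o⇒m≤o M N le)) (h m (m⊔n≤o⇒n≤o M N le))

∀∞-∀< : ∀ (S : ℕ → ℕ → Set) n → (∀ i → i < n → ∀∞ (S i)) →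
        ∀∞[ m ] (∀ i → i < n → S i m)
∀∞-∀< S zero    h = 0 , λ _ _ _ ()
∀∞-∀< S (suc n) h =
  ∀∞-zip combine (∀∞-∀< S n (λ i i<n → h i (m<n⇒m<1+n i<n))) (h n ≤-refl)
  where
  combine : ∀ m → (∀ i → i < n → S i m) → S n m → ∀ i → i < suc n → S i m
  combine m below top i i<1+n with m<1+n⇒m<n∨m≡n i<1+n
  ... | inj₁ i<n  = below i i<n
  ... | inj₂ refl = top

list-bounded : (xs : List ℕ) → ∃[ N ] All (_< N) xs
list-bounded xs = suc (max 0 xs) , All.map s≤s (xs≤max 0 xs)

Fin⇒bounded : ∀ {A} → A ∈ Fin → ∀∞[ m ] ¬ (m ∈ₛ A)
Fin⇒bounded (xs , A⊆xs) with N , xs<N ← list-bounded xs =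
  N , λ m N≤m m∈A → <⇒≱ (All.lookup xs<N (A⊆xs m m∈A)) N≤m

bounded⇒Fin : ∀ {A} → ∀∞[ m ] ¬ (m ∈ₛ A) → A ∈ Fin
bounded⇒Fin (N , h) = upTo N , λ m m∈A →
  ∈-upTo⁺ (≰⇒> λ N≤m → h m N≤m m∈A)

-- Pairing and the colouring of the natural numbers.

next : ℕ × ℕ → ℕ × ℕ
next (zero  , s) = suc s , 0
next (suc r , s) = r , suc s

unpair : ℕ → ℕ × ℕ
unpair zero    = 0 , 0
unpair (suc n) = next (unpair n)

unpair-bounded : ∀ n → proj₁ (unpair n) + proj₂ (unpair n) ≤ n
unpair-bounded zero    = z≤n
unpair-bounded (suc n) with unpair n | unpair-bounded n
... | zero  , s | le = s≤s (subst (_≤ n) (sym (+-identityʳ s)) le)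
... | suc r , s | le = m≤n⇒m≤1+n (subst (_≤ n) (sym (+-suc r s)) le)

unpair-surjective : ∀ r s → ∃[ n ] unpair n ≡ (r , s)
unpair-surjective r s = diagonal (r + s) s r refl
  where
  diagonal : ∀ d s r → r + s ≡ d → ∃[ n ] unpair n ≡ (r , s)
  diagonal d (suc s) r eq
    with n , e ← diagonal d s (suc r) (trans (sym (+-suc r s)) eq) =
    suc n , cong next e
  diagonal d       zero zero    eq = 0 , refl
  diagonal (suc d) zero (suc r) eq
    with n , e ← diagonal d r 0 (trans (sym (+-identityʳ r)) (suc-injective eq)) =
    suc n , cong next e

ℕ↠ℕ² : ℕ ↠ (ℕ × ℕ)
ℕ↠ℕ² = mk↠ₛ {to = unpair} λ (r , s) → unpair-surjective r s

ℕ↠ℕ³ : ℕ ↠ (ℕ × ℕ × ℕ)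
ℕ↠ℕ³ = (↠-id ℕ ×-↠ ℕ↠ℕ²) ↠-∘ ℕ↠ℕ²

ℕ↠ℕ⁴ : ℕ ↠ (ℕ × ℕ × ℕ × ℕ)
ℕ↠ℕ⁴ = (↠-id ℕ ×-↠ ℕ↠ℕ³) ↠-∘ ℕ↠ℕ²

-- Dropping the second half of `unpair x` makes every colour recur: that half can be prescribed
-- freely and is at most `x`.
coords : ℕ → ℕ × ℕ × ℕ × ℕ
coords x = Surjection.to ℕ↠ℕ⁴ (proj₁ (unpair x))

coords-fibre : ∀ c → ∃∞ λ x → coords x ≡ c
coords-fibre c N
  with t , t↦c ← Surjection.strictlySurjective ℕ↠ℕ⁴ c
  with x , e ← unpair-surjective t N =
  x ,
  ≤-trans (≤-reflexive (sym (cong proj₂ e)))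
    (m+n≤o⇒n≤o (proj₁ (unpair x)) (unpair-bounded x)) ,
  trans (cong (Surjection.to ℕ↠ℕ⁴ ∘ proj₁) e) t↦c

-- The ideal.

module _ (E : 𝒫 ℕ) where

  Thin : ℕ → ℕ → ℕ → Set
  Thin p a i = ∀∞[ b ] (∀ x → x ∈ₛ E → coords x ≢ (p , a , i , b))

  Small : ℕ → ℕ → ℕ → Set
  Small p a i = ∀∞[ b ] (∀∞[ x ] (x ∈ₛ E → coords x ≢ (p , a , i , b)))

  Thin⇒Small : ∀ {p a i} → Thin p a i → Small p a i
  Thin⇒Small = ∀∞-map λ b h → 0 , λ x _ → h x

  MemberAt : ℕ → Set
  MemberAt n =
    (∀ p → n ≤ p → ∀∞[ a ] (∀ i → Thin p a i)) ×
    (∀ p → p < n → ∀∞[ a ] (∀ i → n ≤ i → Small p a i))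

  Member : Set
  Member = ∃[ n ] MemberAt n

  -- Raising `n` past `p` trades the first clause at `p` for the weaker second one. This gives two
  -- members a common `n`, as `Member-∪` requires.
  MemberAt-mono : ∀ {m n} → m ≤ n → MemberAt m → MemberAt n
  MemberAt-mono {m} {n} m≤n (thin , small) =
    (λ p n≤p → thin p (≤-trans m≤n n≤p)) , small′
    where
    small′ : ∀ p → p < n → ∀∞[ a ] (∀ i → n ≤ i → Small p a i)
    small′ p _ with <-≤-connex p m
    ... | inj₁ p<m = ∀∞-map (λ a h i n≤i → h i (≤-trans m≤n n≤i)) (small p p<m)
    ... | inj₂ m≤p = ∀∞-map (λ a h i _ → Thin⇒Small (h i)) (thin p m≤p)

  Member⇒Small : Member → ∀ p → ∀∞[ a ] ∃[ i ] Small p a i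
  Member⇒Small (n , thin , small) p with <-≤-connex p n
  ... | inj₁ p<n = ∀∞-map (λ a h → n , h n ≤-refl) (small p p<n)
  ... | inj₂ n≤p = ∀∞-map (λ a h → n , Thin⇒Small (h n)) (thin p n≤p)

Member-downward : ∀ {E F} → E ⊆ₛ F → Member F → Member E
Member-downward E⊆F (n , thin , small) = n ,
  (λ p n≤p → ∀∞-map (λ a h i →
    ∀∞-map (λ b g x → g x ∘ E⊆F x) (h i)) (thin p n≤p)) ,
  (λ p p<n → ∀∞-map (λ a h i n≤i →
    ∀∞-map (λ b → ∀∞-map (λ x g → g ∘ E⊆F x)) (h i n≤i)) (small p p<n))

∪ₛ-elim : ∀ {X : Set} {C : Set} (A B : 𝒫 X) x →
          (x ∈ₛ A → C) → (x ∈ₛ B → C) → x ∈ₛ (A ∪ₛ B) → C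
∪ₛ-elim A B x f g x∈ with A x
... | true  = f refl
... | false = g x∈

Member-∪ : ∀ {E F} → Member E → Member F → Member (E ∪ₛ F)
Member-∪ {E} {F} (m , E∈) (n , F∈)
  with thin  , small  ← MemberAt-mono E (m≤m⊔n m n) E∈
  with thin′ , small′ ← MemberAt-mono F (m≤n⊔m m n) F∈ =
  m ⊔ n ,
  (λ p le → ∀∞-zip (λ a h h′ i →
    ∀∞-zip (λ b g g′ x → ∪ₛ-elim E F x (g x) (g′ x)) (h i) (h′ i))
      (thin p le) (thin′ p le)) ,
  (λ p lt → ∀∞-zip (λ a h h′ i le →
    ∀∞-zip (λ b → ∀∞-zip (λ x → ∪ₛ-elim E F x)) (h i le) (h′ i le))
      (small p lt) (small′ p lt))

lastCoord : ℕ → ℕ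
lastCoord x = proj₂ (proj₂ (proj₂ (coords x)))

-- The finitely many points below `K` have only finitely many last coordinates.
Thin-from-bound : ∀ {E p a i} K →
  (∀ x → x ∈ₛ E → ∀ b → coords x ≡ (p , a , i , b) → x < K) → Thin E p a i
Thin-from-bound K h =
  ∀∞-map (λ b avoid x x∈E eq →
            avoid x (h x x∈E b eq) (cong (proj₂ ∘ proj₂ ∘ proj₂) eq))
    (∀∞-∀< (λ x b → lastCoord x ≢ b) K
      λ x _ → suc (lastCoord x) , λ b lt eq → <⇒≢ lt eq)

Member-finite : ∀ {E} → Finiteₛ E → Member E
Member-finite fin with K , h ← Fin⇒bounded fin =
  0 , (λ p _ → 0 , λ a _ i → Thin-from-bound K λ x x∈E _ _ →
    ≰⇒> λ K≤x → h x K≤x x∈E) , λ p ()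

Member-proper : ¬ Member fullₛ
Member-proper (n , thin , _)
  with a , h ← thin n ≤-refl
  with b , g ← h a ≤-refl 0
  with x , _ , e ← coords-fibre (n , a , 0 , b) 0 = g b ≤-refl x refl e

ideal : Ideal ℕ
ideal = record
  { sets     = Member
  ; downward = Member-downward
  ; ∪-closed = Member-∪
  ; finite-∈ = Member-finite
  ; proper   = Member-proper
  }

-- Closure properties of the finite Borel levels.

Σ⁰-resp-≐ : ∀ {X : Set} {n} {S T : Family X} → S ≐ T → Σ⁰ n S → Σ⁰ n T
Σ⁰-resp-≐ (S⊆T , T⊆S) (open-Σ⁰ o) = open-Σ⁰ λ A A∈T →
  let xs , h = o A (T⊆S A∈T) in xs , λ B eq → S⊆T (h B eq)
Σ⁰-resp-≐ (S⊆T , T⊆S) (union-Σ⁰ β V β< Vᶜ (S⊆V , V⊆S)) =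
  union-Σ⁰ β V β< Vᶜ (S⊆V ∘ T⊆S , S⊆T ∘ V⊆S)

Σ⁰-positive : ∀ {X : Set} {n} {S : Family X} → Σ⁰ n S → 0 < n
Σ⁰-positive (open-Σ⁰ _)             = s≤s z≤n
Σ⁰-positive (union-Σ⁰ _ _ β< _ _) = ≤-<-trans z≤n (β< 0)

-- `union-Σ⁰` cannot occur here: its pieces would have level 0, which `Σ⁰-positive` excludes.
Σ⁰₁⇒Open : ∀ {X : Set} {n} {S : Family X} → Σ⁰ n S → n ≤ 1 → Open S
Σ⁰₁⇒Open (open-Σ⁰ o) _ = o
Σ⁰₁⇒Open (union-Σ⁰ β _ β< Vᶜ _) n≤1 =
  contradiction (<-≤-trans (β< 0) n≤1) (≤⇒≯ (Σ⁰-positive (Vᶜ 0)))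

Σ⁰-⋃ : ∀ {X J : Set} {n} {T : J → Family X} → ℕ ↠ J →
       (∀ j → Σ⁰ n (∁ (T j))) → Σ⁰ (suc n) (λ A → ∃[ j ] T j A)
Σ⁰-⋃ {n = n} {T} e Tᶜ =
  union-Σ⁰ (λ _ → n) (T ∘ to) (λ _ → ≤-refl) (Tᶜ ∘ to)
    ( (λ (j , A∈T) → let t , t↦j = strictlySurjective j in
         t , subst (λ j → T j _) (sym t↦j) A∈T)
    , λ (t , A∈T) → to t , A∈T)
  where open Surjection e using (to; strictlySurjective)

module Classical (em : ExcludedMiddle 0ℓ) where

  dne : ∀ {P : Set} → ¬ ¬ P → P
  dne = decidable-stable em

  ¬∀⇒∃¬ : ∀ {A : Set} {P : A → Set} → ¬ (∀ x → P x) → ∃[ x ] ¬ P x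
  ¬∀⇒∃¬ ¬∀ = dne λ ¬∃ → ¬∀ λ x → dne λ ¬Px → ¬∃ (x , ¬Px)

  ¬∀∞⇒∃∞ : ∀ {S} → ¬ (∀∞[ m ] ¬ S m) → ∃∞ S
  ¬∀∞⇒∃∞ ¬∀∞ N = dne λ none → ¬∀∞ (N , λ m N≤m Sm → none (m , N≤m , Sm))

  χ : ∀ {X : Set} → (X → Set) → 𝒫 X
  χ P x = does (em {P x})

  ∈χ⁺ : ∀ {X : Set} (P : X → Set) x → P x → x ∈ₛ χ P
  ∈χ⁺ P x Px with em {P x}
  ... | yes _  = refl
  ... | no ¬Px = contradiction Px ¬Px

  ∈χ⁻ : ∀ {X : Set} (P : X → Set) x → x ∈ₛ χ P → P x
  ∈χ⁻ P x x∈ with em {P x}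
  ... | yes Px = Px

  module _ {X : Set} where

    ∁∁-≐ : (S : Family X) → S ≐ ∁ (∁ S)
    ∁∁-≐ S = (λ A∈S A∉S → A∉S A∈S) , dne

    Π⁰-⋂ : ∀ {J : Set} {n} {T : J → Family X} → ℕ ↠ J →
           (∀ j → Σ⁰ n (T j)) → Σ⁰ (suc n) (∁ (λ A → ∀ j → T j A))
    Π⁰-⋂ {T = T} e Tσ =
      Σ⁰-resp-≐ ((λ (j , A∉T) h → A∉T (h j)) , ¬∀⇒∃¬)
        (Σ⁰-⋃ {T = ∁ ∘ T} e λ j → Σ⁰-resp-≐ (∁∁-≐ (T j)) (Tσ j))

    Π⁰-closed : (D : X → Set) → Σ⁰ 1 (∁ (λ A → ∀ x → x ∈ₛ A → D x))
    Π⁰-closed D = open-Σ⁰ λ A ¬A⊆D →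
      let x , ¬h = ¬∀⇒∃¬ ¬A⊆D in
      List.[ x ] , λ { B (eq All.∷ _) B⊆D → ¬h λ x∈A → B⊆D x (trans eq x∈A) }

    Σ⁰-universal : ∀ n → Σ⁰ (suc n) (λ (_ : 𝒫 X) → ⊤)
    Σ⁰-universal zero    = open-Σ⁰ λ _ _ → List.[] , λ _ _ → tt
    Σ⁰-universal (suc n) =
      union-Σ⁰ (λ _ → 1) (λ _ _ → ⊤) (λ _ → s≤s (s≤s z≤n))
        (λ _ → open-Σ⁰ λ _ ¬⊤ → contradiction tt ¬⊤)
        ((λ _ → 0 , tt) , λ _ → tt)

    -- `D` does not depend on the set, so the family is either `S` or everything. Bounds such as
    -- `N ≤ a` thus never raise the level.
    Σ⁰-→ : ∀ {n} {D : Set} {S : Family X} →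
           Σ⁰ (suc n) S → Σ⁰ (suc n) (λ A → D → S A)
    Σ⁰-→ {n} {D} Sσ with em {D}
    ... | yes d = Σ⁰-resp-≐ ((λ A∈S _ → A∈S) , λ h → h d) Sσ
    ... | no ¬d =
      Σ⁰-resp-≐ ((λ _ d → contradiction d ¬d) , λ _ → tt) (Σ⁰-universal n)

    Σ⁰-∀∞ : ∀ {n} {T : ℕ → Family X} → (∀ m → Σ⁰ (suc n) (T m)) →
            Σ⁰ (3 + n) (λ A → ∀∞[ m ] T m A)
    Σ⁰-∀∞ Tσ = Σ⁰-⋃ (↠-id ℕ) λ N → Π⁰-⋂ (↠-id ℕ) λ m → Σ⁰-→ (Tσ m)

    -- For fixed `N` both universal quantifiers together describe one closed family, so only the
    -- union over `N` raises the level.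
    Σ⁰₂-∀∞ : (D : ℕ → X → Set) →
             Σ⁰ 2 (λ A → ∀∞[ m ] (∀ x → x ∈ₛ A → D m x))
    Σ⁰₂-∀∞ D = Σ⁰-resp-≐
      ( (λ (N , h) → N , λ m N≤m x x∈A → h x x∈A m N≤m)
      , λ (N , h) → N , λ x x∈A m N≤m → h m N≤m x x∈A)
      (Σ⁰-⋃ (↠-id ℕ) λ N → Π⁰-closed λ x → ∀ m → N ≤ m → D m x)

  -- Borel class of the ideal.

  Σ⁰-Thin : ∀ p a i → Σ⁰ 2 (λ E → Thin E p a i)
  Σ⁰-Thin p a i = Σ⁰₂-∀∞ λ b x → coords x ≢ (p , a , i , b)

  Σ⁰-Small : ∀ p a i → Σ⁰ 4 (λ E → Small E p a i)
  Σ⁰-Small p a i = Σ⁰-∀∞ λ b → Σ⁰-resp-≐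
    ( (λ (N , h) → N , λ x N≤x x∈E → h x x∈E N≤x)
    , λ (N , h) → N , λ x x∈E N≤x → h x N≤x x∈E)
    (Σ⁰-⋃ (↠-id ℕ) λ N →
      Π⁰-closed λ x → N ≤ x → coords x ≢ (p , a , i , b))

  Σ⁰-eventually-Thin : ∀ p → Σ⁰ 4 (λ E → ∀∞[ a ] (∀ i → Thin E p a i))
  Σ⁰-eventually-Thin p = Σ⁰-resp-≐
    ( (λ (N , h) → N , λ a N≤a i → h (a , i) N≤a)
    , λ (N , h) → N , λ (a , i) N≤a → h a N≤a i)
    -- A single intersection over pairs `(a , i)`, in place of two nested ones, keeps the level at
    -- 4.
    (Σ⁰-⋃ (↠-id ℕ) λ N →
      Π⁰-⋂ ℕ↠ℕ² λ (a , i) → Σ⁰-→ {D = N ≤ a} (Σ⁰-Thin p a i))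

  -- One threshold `N`, a maximum of finitely many, serves all `p < n`. Hence one union over
  -- `(n , N)` of one intersection of Σ⁰₄ families gives Σ⁰₆.
  Level : ℕ × ℕ → ℕ × ℕ × ℕ → Family ℕ
  Level (n , N) (p , a , i) E =
    (n ≤ p → ∀∞[ a ] (∀ i → Thin E p a i)) ×
    (p < n → N ≤ a → n ≤ i → Small E p a i)

  Σ⁰-Level : ∀ nN c → Σ⁰ 4 (Level nN c)
  Σ⁰-Level (n , N) (p , a , i) with <-≤-connex p n
  ... | inj₁ p<n = Σ⁰-resp-≐
    ( (λ h → (λ n≤p → contradiction p<n (≤⇒≯ n≤p)) , λ _ N≤a → h N≤a)
    , λ (_ , h) → h p<n)
    (Σ⁰-→ {D = N ≤ a} (Σ⁰-→ {D = n ≤ i} (Σ⁰-Small p a i)))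
  ... | inj₂ n≤p = Σ⁰-resp-≐
    ( (λ h → (λ _ → h) , λ p<n → contradiction p<n (≤⇒≯ n≤p))
    , λ (h , _) → h n≤p)
    (Σ⁰-eventually-Thin p)

  Member≐Level : (λ E → ∃[ nN ] ∀ c → Level nN c E) ≐ Member
  Member≐Level =
    (λ ((n , N) , h) → n ,
      -- The first clause of `Level` ignores the last two entries; the zeros are arbitrary.
      (λ p n≤p → proj₁ (h (p , 0 , 0)) n≤p) ,
      (λ p p<n → N , λ a N≤a i n≤i → proj₂ (h (p , a , i)) p<n N≤a n≤i)) ,
    λ {E} (n , thin , small) →
      let N , h = ∀∞-∀< (λ p a → ∀ i → n ≤ i → Small E p a i) n small in
      (n , N) , λ (p , a , i) →
        thin p , λ p<n N≤a n≤i → h a N≤a p p<n i n≤i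

  Σ⁰₆-Member : Σ⁰ 6 Member
  Σ⁰₆-Member = Σ⁰-resp-≐ Member≐Level
    (Σ⁰-⋃ ℕ↠ℕ² λ nN → Π⁰-⋂ ℕ↠ℕ³ λ c → Σ⁰-Level nN c)

  -- Open and Gδ families through finite initial segments.

  _≈[_]_ : 𝒫 ℕ → ℕ → 𝒫 ℕ → Set
  E ≈[ k ] F = ∀ y → y < k → F y ≡ E y

  Forced : ℕ → Family ℕ → Family ℕ
  Forced k U E = ∀ F → E ≈[ k ] F → F ∈ U

  ≈-sym : ∀ {E F k} → E ≈[ k ] F → F ≈[ k ] E
  ≈-sym E≈F y y<k = sym (E≈F y y<k)

  Forced-resp : ∀ {k U E F} → E ≈[ k ] F → Forced k U E → Forced k U F
  Forced-resp E≈F h G F≈G = h G λ y y<k → trans (F≈G y y<k) (E≈F y y<k)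

  Forced⇒∈ : ∀ {k U E} → Forced k U E → E ∈ U
  Forced⇒∈ {E = E} h = h E λ _ _ → refl

  Open⇒Forced : ∀ {U E} → Open U → E ∈ U → ∀∞[ k ] Forced k U E
  Open⇒Forced {U} {E} o E∈U
    with xs , h ← o E E∈U
    with N , xs<N ← list-bounded xs =
    N , λ k N≤k F E≈F →
      h F (All.map (λ x<N → E≈F _ (<-≤-trans x<N N≤k)) xs<N)

  -- The complement of an open `U` is the intersection over `j` of the clopen families of sets whose
  -- part below `j` does not force `U`. If `U` is a union of closed pieces, their complements are
  -- the open families sought.
  ∁⇒⋂Open : ∀ {n} {U : Family ℕ} → Σ⁰ n U → n ≤ 2 →
    Σ[ O ∈ (ℕ → Family ℕ) ] (∀ j → Open (O j)) × ∁ U ≐ ⋂ ℕ O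
  ∁⇒⋂Open {U = U} (open-Σ⁰ o) _ =
    (λ j E → ¬ Forced j U E) ,
    (λ j E ¬forced → upTo j , λ F F≡E forced →
      ¬forced (Forced-resp
        (λ y y<j → sym (All.lookup F≡E (∈-upTo⁺ y<j))) forced)) ,
    (λ E∉U j forced → E∉U (Forced⇒∈ forced)) ,
    λ unforced E∈U →
      let N , h = Open⇒Forced o E∈U in unforced N (h N ≤-refl)
  ∁⇒⋂Open (union-Σ⁰ β V β< Vᶜ (U⊆V , V⊆U)) n≤2 =
    (λ j → ∁ (V j)) ,
    (λ j → Σ⁰₁⇒Open (Vᶜ j) (≤-pred (≤-trans (β< j) n≤2))) ,
    (λ E∉U j E∈V → E∉U (V⊆U (j , E∈V))) ,
    λ E∉V E∈U → let j , E∈V = U⊆V E∈U in E∉V j E∈V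

  Σ⁰₃⇒⋃⋂Open : ∀ {n} {S : Family ℕ} → Σ⁰ n S → n ≤ 3 →
    Σ[ O ∈ (ℕ → ℕ → Family ℕ) ]
      (∀ i j → Open (O i j)) × S ≐ (λ E → ∃[ i ] ∀ j → O i j E)
  Σ⁰₃⇒⋃⋂Open {S = S} (open-Σ⁰ o) _ =
    (λ _ _ → S) , (λ _ _ → o) , (λ E∈S → 0 , λ _ → E∈S) , λ (_ , h) → h 0
  Σ⁰₃⇒⋃⋂Open (union-Σ⁰ β V β< Vᶜ (S⊆V , V⊆S)) n≤3 =
    (λ i → proj₁ (gδ i)) ,
    (λ i → proj₁ (proj₂ (gδ i))) ,
    (λ E∈S → let i , E∈V = S⊆V E∈S in
      i , proj₁ (proj₂ (proj₂ (gδ i))) (λ E∉V → E∉V E∈V)) ,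
    λ (i , h) → V⊆S (i , dne (proj₂ (proj₂ (proj₂ (gδ i))) h))
    where
    gδ : ∀ i → Σ[ O ∈ (ℕ → Family ℕ) ] (∀ j → Open (O j)) × ∁ (∁ (V i)) ≐ ⋂ ℕ O
    gδ i = ∁⇒⋂Open (Vᶜ i) (≤-pred (≤-trans (β< i) n≤3))

  -- The diagonal set and the rank.

  module Diagonal (O : ℕ → ℕ → Family ℕ) (O-open : ∀ i j → Open (O i j)) where

    -- In terms of the function `f` of the outline this is `f k i ≤ v`. Stating it as a bound avoids
    -- naming a least `j`, which need not exist.
    Clear : ℕ → 𝒫 ℕ → ℕ → ℕ → Set
    Clear k E i v = ∀ i′ → i′ ≤ i → ∃[ j ] j ≤ v × ¬ Forced k (O i′ j) E

    Clear-resp : ∀ {k E F i v} → E ≈[ k ] F → Clear k E i v → Clear k F i v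
    Clear-resp {E = E} E≈F clear i′ i′≤i =
      let j , j≤v , ¬forced = clear i′ i′≤i in
      j , j≤v , λ forced → ¬forced (Forced-resp (≈-sym {E} E≈F) forced)

    Omit : ℕ → 𝒫 ℕ → ℕ × ℕ × ℕ × ℕ → Set
    Omit k E (p , a , i , b) = Clear k E p a × Clear k E i b

    Keep : 𝒫 ℕ → ℕ → Set
    Keep E k = ¬ Omit k E (coords k)

    -- The value of `diag` at `k` depends on all earlier values, so the recursion builds initial
    -- segments; `prefix k` is meaningful only below `k`.
    prefix : ℕ → 𝒫 ℕ
    prefix zero    _ = false
    prefix (suc k) y with y <? k
    ... | yes _ = prefix k y
    ... | no  _ = χ (Keep (prefix k)) k

    diag : 𝒫 ℕ
    diag x = χ (Keep (prefix x)) x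

    prefix-≈ : ∀ k → prefix k ≈[ k ] diag
    prefix-≈ (suc k) y y<1+k with y <? k
    ... | yes y<k = prefix-≈ k y y<k
    ... | no y≮k with refl ← ≤-antisym (≤-pred y<1+k) (≮⇒≥ y≮k) = refl

    Omit-diag : ∀ {x c} → coords x ≡ c →
                Omit x (prefix x) (coords x) → Omit x diag c
    Omit-diag {x} refl (cl , cl′) =
      Clear-resp (prefix-≈ x) cl , Clear-resp (prefix-≈ x) cl′

    ∈diag : ∀ {x c} → coords x ≡ c → x ∈ₛ diag → ¬ Omit x diag c
    ∈diag {x} refl x∈ (cl , cl′) = ∈χ⁻ (Keep (prefix x)) x x∈
      ( Clear-resp (≈-sym {prefix x} (prefix-≈ x)) cl
      , Clear-resp (≈-sym {prefix x} (prefix-≈ x)) cl′)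

    ∉diag : ∀ {x c} → coords x ≡ c → x ∈ₛ ∁ₛ diag → Omit x diag c
    ∉diag {x} eq x∈ = Omit-diag eq
      (dne λ ¬omit → contradiction (trans (sym x∈) (cong not (∈χ⁺ (Keep (prefix x)) x ¬omit))) λ ())

    -- If `diag ∉ O i′ j`, no finite part forces it in, so the same `j` works at every stage `k`;
    -- `v` has only to bound these `j` for `i′ ≤ i`.
    eventually-Clear : (∀ i → ∃[ j ] diag ∉ O i j) →
                       ∀ i → ∀∞[ v ] (∀ k → Clear k diag i v)
    eventually-Clear escapes i = ∀∞-map clear (∀∞-∀< Escapes (suc i) λ i′ _ →
      let j , diag∉ = escapes i′ in j , λ v j≤v → j , j≤v , diag∉)
      where
      Escapes : ℕ → ℕ → Set
      Escapes i′ v = ∃[ j ] j ≤ v × diag ∉ O i′ j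

      clear : ∀ v → (∀ i′ → i′ < suc i → Escapes i′ v) → ∀ k → Clear k diag i v
      clear v h k i′ i′≤i = let j , j≤v , diag∉ = h i′ (s≤s i′≤i) in
        j , j≤v , diag∉ ∘ Forced⇒∈

    -- By openness each of the finitely many `O n j` with `j ≤ v` is forced from some stage on, and
    -- `n` is among the indices up to `i`.
    eventually-unclear : ∀ {n i} → n ≤ i → (∀ j → diag ∈ O n j) →
                         ∀ v → ∀∞[ k ] ¬ Clear k diag i v
    eventually-unclear {n} {i} n≤i diag∈ v =
      ∀∞-map unclear (∀∞-∀< (λ j k → Forced k (O n j) diag) (suc v) λ j _ →
        Open⇒Forced (O-open n j) (diag∈ j))
      where
      unclear : ∀ k → (∀ j → j < suc v → Forced k (O n j) diag) →
                ¬ Clear k diag i v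
      unclear k forced clear = let j , j≤v , ¬forced = clear n n≤i in
        ¬forced (forced j (s≤s j≤v))

    escaping⇒Member : (∀ i → ∃[ j ] diag ∉ O i j) → Member diag
    escaping⇒Member escapes = 0 ,
      (λ p _ → ∀∞-map
        (λ a clear-a i → ∀∞-map
          (λ b clear-b x x∈ eq → ∈diag eq x∈ (clear-a x , clear-b x))
          (eventually-Clear escapes i))
        (eventually-Clear escapes p)) ,
      λ p ()

    -- An omitted point satisfies both halves of `Omit`. For `p ≥ n` the half at `p` fails late,
    -- leaving finitely many points for each `a`. For `p < n` the half at `i ≥ n` fails late for
    -- each `b` separately, which yields only `Small`.
    caught⇒Member-∁ : ∀ n → (∀ j → diag ∈ O n j) → Member (∁ₛ diag)
    caught⇒Member-∁ n caught = n ,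
      (λ p n≤p → 0 , λ a _ i →
        let K , unclear = eventually-unclear n≤p caught a in
        Thin-from-bound K λ x x∈ b eq →
          ≰⇒> λ K≤x → unclear x K≤x (proj₁ (∉diag eq x∈))) ,
      λ p _ → 0 , λ a _ i n≤i → 0 , λ b _ →
        ∀∞-map (λ x unclear x∈ eq → unclear (proj₂ (∉diag eq x∈)))
          (eventually-unclear n≤i caught b)

  rank>2 : rk Member > 2
  rank>2 β β≤2 (S , Sσ , Member⊆S , disjoint) = diag∉S (Member⊆S diag∈Member)
    where
    rep = Σ⁰₃⇒⋃⋂Open Sσ (s≤s β≤2)
    S≐ = proj₂ (proj₂ rep)
    open Diagonal (proj₁ rep) (proj₁ (proj₂ rep))

    diag∉S : diag ∉ S
    diag∉S diag∈S = let n , caught = proj₁ S≐ diag∈S in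
      disjoint diag
        ( diag∈S
        , ∁ₛ diag , caught⇒Member-∁ n caught , λ x → sym (not-involutive (diag x)))

    diag∈Member : Member diag
    diag∈Member = escaping⇒Member λ i →
      ¬∀⇒∃¬ λ caught → diag∉S (proj₂ S≐ (i , caught))

  -- No copy of Fin³ in the ideal.

  ⊗-intro : ∀ {Y : Set} (𝒥 : Family Y) (A : 𝒫 (ℕ × Y)) →
            ∀∞[ x ] (section A x ∈ 𝒥) → A ∈ Fin ⊗ 𝒥
  ⊗-intro 𝒥 A h =
    χ Large , (λ x → mk⇔ (∈χ⁻ Large x) (∈χ⁺ Large x)) ,
    bounded⇒Fin (∀∞-map (λ x x∈𝒥 large → ∈χ⁻ Large x large x∈𝒥) h)
    where
    Large : ℕ → Set
    Large x = section A x ∉ 𝒥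

  Fin²-intro : ∀ (A : 𝒫 (ℕ × ℕ)) →
               ∀∞[ j ] (∀∞[ k ] ¬ ((j , k) ∈ₛ A)) → A ∈ Fin^[1+ 1 ]
  Fin²-intro A h = ⊗-intro Fin A (∀∞-map (λ j → bounded⇒Fin) h)

  Initial : ℕ → ℕ × ℕ × ℕ → Set
  Initial r (q , _) = q ≤ r

  initial : ℕ → 𝒫 (ℕ × ℕ × ℕ)
  initial r = χ (Initial r)

  initial-Fin³ : ∀ r → initial r ∈ Fin^[1+ 2 ]
  initial-Fin³ r = ⊗-intro Fin^[1+ 1 ] (initial r) (suc r , λ q r<q →
    Fin²-intro (section (initial r) q) (0 , λ j _ → 0 , λ k _ z∈ →
      <⇒≱ r<q (∈χ⁻ (Initial r) (q , j , k) z∈)))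

  Thinning : (ℕ → ℕ × ℕ × ℕ) → Set₁
  Thinning y = Σ[ M ∈ (ℕ → Set) ] ∃∞ M ×
    (∀ q → ∀∞[ j ] (∀∞[ m ] (M m → ∀ k → y m ≢ (q , j , k))))

  -- Either some column `(q₀ , j₀ , -)` receives infinitely many terms, and keeping only those
  -- empties every other column, or each column receives finitely many, and all terms can be kept.
  thinning : ∀ y → Thinning y
  thinning y with em {∃[ q ] ∃[ j ] ∃∞ (λ m → ∃[ k ] y m ≡ (q , j , k))}
  ... | yes (q₀ , j₀ , frequent) =
    (λ m → ∃[ k ] y m ≡ (q₀ , j₀ , k)) , frequent ,
    λ q → suc j₀ , λ j j₀<j → 0 , λ m _ (k₀ , eq₀) k eq →
      <⇒≢ j₀<j (cong (proj₁ ∘ proj₂) (trans (sym eq₀) eq))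
  ... | no rare =
    (λ _ → ⊤) , (λ N → N , ≤-refl , tt) ,
    λ q → 0 , λ j _ → ∀∞-map (λ m none _ k eq → none (k , eq))
      (dne λ ¬rare → rare (q , j , ¬∀∞⇒∃∞ ¬rare))

  module Selection (y : ℕ → ℕ → ℕ × ℕ × ℕ)
    (outside : ∀ r m → r < proj₁ (y r m)) (thinned : ∀ r → Thinning (y r)) where

    M : ℕ → ℕ → Set
    M r = proj₁ (thinned r)

    M-frequent : ∀ r → ∃∞ (M r)
    M-frequent r = proj₁ (proj₂ (thinned r))

    M-late : ∀ r q → ∀∞[ j ] (∀∞[ m ] (M r m → ∀ k → y r m ≢ (q , j , k)))
    M-late r = proj₂ (proj₂ (thinned r))

    Chosen : ℕ × ℕ × ℕ → Set
    Chosen z = ∃[ r ] ∃[ m ] M r m × y r m ≡ z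

    -- By `outside` only stages `r < q` reach section `q`, and for almost all `j` each of them meets
    -- column `j` in finitely many terms.
    Chosen-Fin³ : χ Chosen ∈ Fin^[1+ 2 ]
    Chosen-Fin³ = ⊗-intro Fin^[1+ 1 ] (χ Chosen) (0 , λ q _ →
      Fin²-intro (section (χ Chosen) q) (∀∞-map (column q)
      (∀∞-∀< (λ r j → ∀∞[ m ] (M r m → ∀ k → y r m ≢ (q , j , k))) q
        λ r _ → M-late r q)))
      where
      row : ∀ q j r → ∀∞[ m ] (M r m → ∀ k → y r m ≢ (q , j , k)) →
            ∀∞[ k ] (∀ m → M r m → y r m ≢ (q , j , k))
      row q j r (K , late) = ∀∞-map all
        (∀∞-∀< (λ m k → y r m ≢ (q , j , k)) K λ m _ →
          suc (proj₂ (proj₂ (y r m))) , λ k lt eq →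
            <⇒≢ lt (cong (proj₂ ∘ proj₂) eq))
        where
        all : ∀ k → (∀ m → m < K → y r m ≢ (q , j , k)) →
              ∀ m → M r m → y r m ≢ (q , j , k)
        all k early m m∈M with <-≤-connex m K
        ... | inj₁ m<K = early m m<K
        ... | inj₂ K≤m = late m K≤m m∈M k

      column : ∀ q j →
        (∀ r → r < q → ∀∞[ m ] (M r m → ∀ k → y r m ≢ (q , j , k))) →
        ∀∞[ k ] ¬ ((q , j , k) ∈ₛ χ Chosen)
      column q j rows = ∀∞-map none
        (∀∞-∀< (λ r k → ∀ m → M r m → y r m ≢ (q , j , k)) q
          λ r r<q → row q j r (rows r r<q))
        where
        none : ∀ k → (∀ r → r < q → ∀ m → M r m → y r m ≢ (q , j , k)) →
               ¬ ((q , j , k) ∈ₛ χ Chosen)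
        none k h z∈ with r , m , m∈M , eq ← ∈χ⁻ Chosen (q , j , k) z∈ =
          h r (subst (r <_) (cong proj₁ eq) (outside r m)) m m∈M eq

  module NoCopy (Φ : ℕ → ℕ × ℕ × ℕ)
    (pull : ∀ A → A ∈ Fin^[1+ 2 ] → Member (A ∘ Φ)) where

    module Stage (r : ℕ) where

      p : ℕ
      p = proj₁ (coords r)

      small = Member⇒Small (initial r ∘ Φ) (pull (initial r) (initial-Fin³ r)) p

      a : ℕ
      -- The maximum with `r` makes `a` unbounded along the infinitely many stages sharing one `p`.
      a = proj₁ small ⊔ r

      i : ℕ
      i = proj₁ (proj₂ small a (m≤m⊔n _ r))

      column : Small (initial r ∘ Φ) p a i
      column = proj₂ (proj₂ small a (m≤m⊔n _ r))

      b₀ : ℕ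
      b₀ = proj₁ column

      -- The lower bound on `x` is the threshold from `column` past which points of this colour lie
      -- outside `initial r ∘ Φ`.
      point : ∀ m → ∃[ x ] proj₁ (proj₂ column (b₀ + m) (m≤m+n b₀ m)) ≤ x ×
                coords x ≡ (p , a , i , b₀ + m)
      point m = coords-fibre (p , a , i , b₀ + m) _

      s : ℕ → ℕ
      s m = proj₁ (point m)

      s-coords : ∀ m → coords (s m) ≡ (p , a , i , b₀ + m)
      s-coords m = proj₂ (proj₂ (point m))

      s-outside : ∀ m → r < proj₁ (Φ (s m))
      s-outside m = ≰⇒> λ q≤r →
        proj₂ (proj₂ column (b₀ + m) (m≤m+n b₀ m)) (s m) (proj₁ (proj₂ (point m)))
          (∈χ⁺ (Initial r) (Φ (s m)) q≤r) (s-coords m)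

    open Stage using (s; s-coords; s-outside)
    open Selection (λ r → Φ ∘ s r) s-outside (λ r → thinning (Φ ∘ s r))

    Chosen-positive : ¬ Member (χ Chosen ∘ Φ)
    Chosen-positive (n , thin , _) =
      let α , h       = thin n ≤-refl
          -- Prescribing the first coordinate of `coords r` gives a stage with `p` equal to `n`, and
          -- `α ≤ r` brings its `a` past the threshold. The zeros are arbitrary.
          r , α≤r , e = coords-fibre (n , 0 , 0 , 0) α
          b , g       = h (Stage.a r) (≤-trans α≤r (m≤n⊔m _ r)) (Stage.i r)
          m , b≤m , c = M-frequent r b
      in g (Stage.b₀ r + m) (≤-trans b≤m (m≤n+m m _)) (s r m)
           (∈χ⁺ Chosen (Φ (s r m)) (r , m , c , refl))
           (trans (s-coords r m) (cong₂ _,_ (cong proj₁ e) refl))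

    no-copy : ⊥
    no-copy = Chosen-positive (pull (χ Chosen) Chosen-Fin³)

theorem2p5 : (∀ {ℓ} → ExcludedMiddle ℓ) →
    Σ[ X ∈ Set ] CountablyInfinite X × (Σ[ I ∈ Ideal X ]
    (Σ⁰ 6 (Ideal.sets I) × rk (Ideal.sets I) > 2 × ¬ (Fin^[1+ 2 ] ⊑ Ideal.sets I)))
theorem2p5 em = ℕ , ⤖-id ℕ , ideal , Σ⁰₆-Member , rank>2 ,
  λ (f , pull) → NoCopy.no-copy (Bijection.to f) pull
  where open Classical em
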